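{- Let $r,r'\ge 2$ and $k\ge 1$ be integers with $r'<r$ and $W(r',k)<W(r,k)$. Let $n$ be the positive integer with $r^{n}\le W(r,k)<r^{n+1}$, so that $W(r,k)=b_n r^n+b_{n-1}r^{n-1}+\cdots+b_0$ with $b_n\in[1,r-1]$, $b_{n-1},\dots,b_0\in[0,r-1]$ integers, and let $n'$ be the positive integer with $r'^{\,n'}\le W(r',k)<r'^{\,n'+1}$ (the leading exponent of the base-$r'$ expansion of $W(r',k)$). Suppose $n'\le n$. Then the inequality $W(r,k)<r^{k^{2}}$ is true only if $k\in[\sqrt{n+1},\infty)$.
   Context: For positive integers $r,k$, the van der Waerden number $W(r,k)$ is the least positive integer $N$ such that for every colouring of the integers $1,\dots,N$ with $r$ colours there is a monochromatic arithmetic progression with $k$ terms. For $r\ge 2$, the base-$r$ expansion of a positive integer $N$ is the unique expression $N=b_m r^m+\cdots+b_0$ with digits $b_i\in\{0,\dots,r-1\}$ and $b_m\ne 0$; $m$ is its leading exponent, so $r^m\le N<r^{m+1}$. -}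

module Defs where

open import Level using (0ℓ)
open import Data.Fin using (Fin; toℕ; fromℕ)
open import Data.Integer using (+_)
open import Data.Nat using (ℕ; suc; _+_; _*_; _^_; _≤_)
open import Data.Product using (_×_; ∃; ∃-syntax)
open import Data.Rational as ℚ using (ℚ; 0ℚ)
open import Data.Sum using (_⊎_)
open import Data.Vec using (sum; tabulate)
open import Relation.Binary.PropositionalEquality using (_≡_)
open import Relation.Unary using (Pred; _⊆_)

-- The element x : Fin N stands for the integer suc (toℕ x), so that Fin N
-- represents {1, …, N}.
Colouring : ℕ → ℕ → Set
Colouring N r = Fin N → Fin r

IsAP : ∀ {k N} → (Fin k → Fin N) → Set
IsAP t = ∃[ a ] ∃[ d ] (1 ≤ d × (∀ i → suc (toℕ (t i)) ≡ a + toℕ i * d))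

HasMonochromaticAP : ∀ {N r} → ℕ → Colouring N r → Set
HasMonochromaticAP {N} k c =
  ∃ λ (t : Fin k → Fin N) → IsAP t × (∃[ colour ] (∀ i → c (t i) ≡ colour))

VdWProperty : ℕ → ℕ → ℕ → Set
VdWProperty r k N = (c : Colouring N r) → HasMonochromaticAP k c

-- N = W(r,k).  The van der Waerden number is given by its graph: a function
-- W : ℕ → ℕ → ℕ would need a proof of van der Waerden's theorem.
record IsVdWNumber (r k N : ℕ) : Set where
  field
    positive : 1 ≤ N
    property : VdWProperty r k N
    least    : ∀ M → 1 ≤ M → VdWProperty r k M → N ≤ M

-- N = b m * r ^ m + ⋯ + b 0 with b m ≢ 0.
record IsBaseExpansion (r N m : ℕ) (b : Fin (suc m) → Fin r) : Set where
  field
    expansion : N ≡ sum (tabulate λ i → toℕ (b i) * r ^ toℕ i)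
    leading   : 1 ≤ toℕ (b (fromℕ m))

-- A real number is represented by the set of rationals strictly below it (its
-- lower Dedekind cut); the order of the reals is then inclusion.
Cut : Set₁
Cut = Pred ℚ 0ℓ

fromNat : ℕ → Cut
fromNat m q = q ℚ.< (+ m) ℚ./ 1

√ : ℕ → Cut
√ m q = q ℚ.< 0ℚ ⊎ q ℚ.* q ℚ.< (+ m) ℚ./ 1

[_,∞[ : Cut → Pred Cut 0ℓ
[ x ,∞[ y = x ⊆ y

{-# OPTIONS --safe #-}
module Submission where

open import Defs
open import Data.Fin using (Fin)
open import Data.Integer as ℤ using (+_)
import Data.Integer.Properties as ℤ
open import Data.Nat using (ℕ; suc; _+_; _*_; _^_; _≤_; _<_; NonZero; >-nonZero; z≤n; s≤s)
open import Data.Nat.Coprimality as Coprimality using (1-coprimeTo)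
open import Data.Nat.Properties
open import Data.Rational as ℚ using (mkℚ; 0ℚ)
import Data.Rational.Properties as ℚ
open import Data.Sum using (inj₁; inj₂)
open import Relation.Binary.PropositionalEquality
open import Relation.Nullary using (yes; no; contradiction)
open import Relation.Unary using (_∈_)

-- The chain `r ^ n ≤ W < r ^ (k ^ 2)` forces `n < k ^ 2`, that is `n + 1 ≤ k ^ 2`, because powers
-- of `r` grow with the exponent. Taking square roots finishes the proof; with reals as lower cuts,
-- this means that every rational in `√ (n + 1)` lies below `k`, which `fromNat∈[√,∞[` proves by
-- squaring.

^-cancelʳ-< : ∀ r .{{_ : NonZero r}} {m n} → r ^ m < r ^ n → m < n
^-cancelʳ-< r lt = ≰⇒> λ n≤m → <⇒≱ lt (^-monoʳ-≤ r n≤m)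

n^2≡n*n : ∀ n → n ^ 2 ≡ n * n
n^2≡n*n n = cong (n *_) (*-identityʳ n)

-- `_/_` divides by a gcd and is stuck on a variable `n`; in the `mkℚ` form, products and
-- comparisons compute down to the integer numerators.
/1≡mkℚ : ∀ n → (+ n) ℚ./ 1 ≡ mkℚ (+ n) 0 (Coprimality.sym (1-coprimeTo n))
/1≡mkℚ n = ℚ.normalize-coprime (Coprimality.sym (1-coprimeTo n))

/1-homo-* : ∀ m n → ((+ m) ℚ./ 1) ℚ.* ((+ n) ℚ./ 1) ≡ (+ (m * n)) ℚ./ 1
/1-homo-* m n =
  trans (cong₂ ℚ._*_ (/1≡mkℚ m) (/1≡mkℚ n)) (cong (ℚ._/ 1) (sym (ℤ.pos-* m n)))

/1-mono-≤ : ∀ {m n} → m ≤ n → (+ m) ℚ./ 1 ℚ.≤ (+ n) ℚ./ 1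
/1-mono-≤ {m} {n} m≤n = subst₂ ℚ._≤_ (sym (/1≡mkℚ m)) (sym (/1≡mkℚ n))
  (ℚ.*≤* (ℤ.*-monoʳ-≤-nonNeg (+ 1) (ℤ.+≤+ m≤n)))

square-mono-≤ : ∀ {p q} → 0ℚ ℚ.≤ p → p ℚ.≤ q → p ℚ.* p ℚ.≤ q ℚ.* q
square-mono-≤ {p} {q} 0≤p p≤q = ℚ.≤-trans
  (ℚ.*-monoˡ-≤-nonNeg p {{ℚ.nonNegative 0≤p}} p≤q)
  (ℚ.*-monoʳ-≤-nonNeg q {{ℚ.nonNegative (ℚ.≤-trans 0≤p p≤q)}} p≤q)

fromNat∈[√,∞[ : ∀ m k → m ≤ k ^ 2 → fromNat k ∈ [ √ m ,∞[
-- `0ℚ` is `(+ 0) / 1` by computation, so `q < 0 ≤ k`.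
fromNat∈[√,∞[ m k m≤k² (inj₁ q<0) = ℚ.<-≤-trans q<0 (/1-mono-≤ {0} {k} z≤n)
fromNat∈[√,∞[ m k m≤k² {q} (inj₂ q²<m) with q ℚ.<? (+ k) ℚ./ 1
... | yes q<k = q<k
-- Here `0 ≤ k ≤ q`, so squaring preserves the order and `m ≤ k * k ≤ q * q`, against `q * q < m`.
... | no  q≮k = contradiction (ℚ.<-≤-trans q²<m m≤q²) (ℚ.<-irrefl refl)
  where
  open ℚ.≤-Reasoning
  m≤q² : (+ m) ℚ./ 1 ℚ.≤ q ℚ.* q
  m≤q² = begin
    (+ m) ℚ./ 1                      ≤⟨ /1-mono-≤ {m} {k * k} (subst (m ≤_) (n^2≡n*n k) m≤k²) ⟩
    (+ (k * k)) ℚ./ 1                ≡⟨ /1-homo-* k k ⟨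
    ((+ k) ℚ./ 1) ℚ.* ((+ k) ℚ./ 1)  ≤⟨ square-mono-≤ (/1-mono-≤ {0} {k} z≤n) (ℚ.≮⇒≥ q≮k) ⟩
    q ℚ.* q                          ∎

theorem5p1 : (r r′ k : ℕ) → 2 ≤ r → 2 ≤ r′ → 1 ≤ k → r′ < r →
    (W W′ : ℕ) → IsVdWNumber r k W → IsVdWNumber r′ k W′ → W′ < W →
    (n : ℕ) → 1 ≤ n → r ^ n ≤ W → W < r ^ (n + 1) →
    (b : Fin (suc n) → Fin r) → IsBaseExpansion r W n b →
    (n′ : ℕ) → 1 ≤ n′ → r′ ^ n′ ≤ W′ → W′ < r′ ^ (n′ + 1) →
    n′ ≤ n →
    W < r ^ (k ^ 2) → fromNat k ∈ [ √ (n + 1) ,∞[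
theorem5p1 r _ k 2≤r _ _ _ _ _ _ _ _ n _ rⁿ≤W _ _ _ _ _ _ _ _ W<rᵏ² {q} =
  fromNat∈[√,∞[ (n + 1) k n+1≤k² {q}
  where
  instance
    r≢0 : NonZero r
    r≢0 = >-nonZero (≤-trans (s≤s z≤n) 2≤r)

  n+1≤k² : n + 1 ≤ k ^ 2
  -- `n < k ^ 2` unfolds to `suc n ≤ k ^ 2`, which supplies the extra 1 under the root.
  n+1≤k² = subst (_≤ k ^ 2) (+-comm 1 n) (^-cancelʳ-< r (≤-<-trans rⁿ≤W W<rᵏ²))
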